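{- Consider the limiting behavior of $\operatorname{opt}(\mathrm{IP}(k,\mu))$ when $k \to \infty$ and $\mu = k/(k-1)$. One has $$T_\infty := \lim_{k\to\infty} \operatorname{opt}\left(\mathrm{IP}\left(k, \frac{k}{k-1}\right)\right) \approx 1.691030206757254 .$$ The same constant $T_\infty$ is obtained as the limit of $\operatorname{opt}(\mathrm{IP}(k,\mu))$ as $k\to\infty$ for $\mu = k/(k-2)$ and for $\mu = k(k-2)/(k^2-3k+1)$.
   Context: For an integer $k \ge 1$ and a real $\mu\in[0,k]$, $\operatorname{opt}(\mathrm{IP}(k,\mu))$ denotes the optimal value of the integer linear program $$\max_{z \in \mathbb{Z}_{\ge 0}^{k-1}} \ \mu + \sum_{j=1}^{k-1} z_j\left(\frac{1}{j} - \frac{\mu}{j+1}\right) \quad \text{where} \quad \sum_{j=1}^{k-1} \frac{z_j}{j+1} < 1.$$ -}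

module Defs where

open import Data.Nat.Base as ℕ using (ℕ; zero; suc)
import Data.Nat.Properties as ℕₚ
open import Data.Integer.Base as ℤ using (+_)
import Data.Integer.Properties as ℤₚ
open import Data.Rational.Base
  using (ℚ; 0ℚ; 1ℚ; _/_; _+_; _-_; _*_; ∣_∣; _≤_; _<_)
import Data.Rational.Properties as ℚₚ
import Data.Rational.Unnormalised.Base as ℚᵘ
import Data.Rational.Unnormalised.Properties as ℚᵘₚ
open import Data.Fin.Base using (Fin; zero; suc; toℕ)
import Data.Fin.Properties as Finₚ
open import Data.List.Base using (List; [_]; filter; upTo; cartesianProductWith)
open import Data.List.Membership.Propositional using (_∈_)
open import Data.List.Membership.Propositional.Properties
  using (∈-cartesianProductWith⁺; ∈-upTo⁺; ∈-filter⁺)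
open import Data.List.Relation.Unary.All as All using (All)
open import Data.List.Relation.Unary.All.Properties using (all-filter)
open import Data.List.Relation.Unary.Any using (here)
import Data.List.Extrema
open import Data.Product.Base using (∃-syntax; _×_; _,_; proj₁; proj₂)
open import Data.Vec.Functional using (Vector; _∷_; [])
open import Algebra.Bundles using (CommutativeRing)
open import Function.Base using (_∘_)
open import Relation.Binary.Bundles using (DecTotalOrder)
open import Relation.Nullary.Decidable using (Dec)
open import Relation.Binary.PropositionalEquality
  using (_≡_; _≗_; refl; sym; cong; cong₂; subst; subst₂)

open import Algebra.Properties.Semiring.Sum
  (CommutativeRing.semiring ℚₚ.+-*-commutativeRing) public
  using (sum; sum-syntax; sum-cong-≗)

-- The coordinates of z ∈ ℤ≥0^{k-1} are indexed by i = 0 , … , k-2, with j = i + 1.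
-- Only rational μ are needed, so all objective values, and the optimum, are rational.

idx : ∀ {n} → Fin n → ℕ
idx i = suc (toℕ i)

objective : ∀ k → ℚ → Vector ℕ (k ℕ.∸ 1) → ℚ
objective k μ z =
  μ + ∑[ i < k ℕ.∸ 1 ]
        ((+ z i / 1) * ((+ 1 / idx i) - μ * (+ 1 / suc (idx i))))

weight : ∀ k → Vector ℕ (k ℕ.∸ 1) → ℚ
weight k z = ∑[ i < k ℕ.∸ 1 ] (+ z i / suc (idx i))

Feasible : ∀ k → Vector ℕ (k ℕ.∸ 1) → Set
Feasible k z = weight k z < 1ℚ

IsOptimalValue : ℕ → ℚ → ℚ → Set
IsOptimalValue k μ v =
    (∃[ z ] Feasible k z × objective k μ z ≡ v)
  × (∀ z → Feasible k z → objective k μ z ≤ v)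

-- The optimum is attained because feasibility forces z i < k.

private

  sum-nonNeg : ∀ {n} (f : Vector ℚ n) → (∀ i → 0ℚ ≤ f i) → 0ℚ ≤ sum f
  sum-nonNeg {zero}  f 0≤f = ℚₚ.≤-refl
  sum-nonNeg {suc n} f 0≤f =
    subst (_≤ sum f) (ℚₚ.+-identityˡ 0ℚ)
      (ℚₚ.+-mono-≤ (0≤f zero) (sum-nonNeg (f ∘ suc) (0≤f ∘ suc)))

  term≤sum : ∀ {n} (f : Vector ℚ n) → (∀ i → 0ℚ ≤ f i) → ∀ i → f i ≤ sum f
  term≤sum f 0≤f zero =
    subst (_≤ sum f) (ℚₚ.+-identityʳ (f zero))
      (ℚₚ.+-monoʳ-≤ (f zero) (sum-nonNeg (f ∘ suc) (0≤f ∘ suc)))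
  term≤sum f 0≤f (suc i) =
    subst (_≤ sum f) (ℚₚ.+-identityˡ (f (suc i)))
      (ℚₚ.+-mono-≤ (0≤f zero) (term≤sum (f ∘ suc) (0≤f ∘ suc) i))

  0≤m/n : ∀ m n .{{_ : ℕ.NonZero n}} → 0ℚ ≤ + m / n
  0≤m/n m n = ℚₚ.nonNegative⁻¹ (+ m / n) {{ℚₚ.normalize-nonNeg m n}}

  m/n<1⇒m<n : ∀ m n → + m / suc n < 1ℚ → m ℕ.< suc n
  m/n<1⇒m<n m n m/n<1 with
    ℚᵘₚ.<-respˡ-≃ (ℚₚ.toℚᵘ-fromℚᵘ (ℚᵘ.mkℚᵘ (+ m) n)) (ℚₚ.toℚᵘ-mono-< m/n<1)
  ... | ℚᵘ.*<* m*1<1*n =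
    ℤₚ.drop‿+<+ (subst₂ ℤ._<_ (ℤₚ.*-identityʳ (+ m)) (ℤₚ.*-identityˡ (+ suc n)) m*1<1*n)

  feasible-bounded : ∀ k z → Feasible k z → ∀ i → z i ℕ.< suc (k ℕ.∸ 1)
  feasible-bounded k z w<1 i =
    ℕₚ.<-≤-trans
      (m/n<1⇒m<n (z i) (idx i) (ℚₚ.≤-<-trans (term≤sum _ (λ j → 0≤m/n (z j) (suc (idx j))) i) w<1))
      (ℕ.s≤s (Finₚ.toℕ<n i))

  vectors : ∀ n → ℕ → List (Vector ℕ n)
  vectors zero    b = [ [] ]
  vectors (suc n) b = cartesianProductWith _∷_ (upTo b) (vectors n b)

  -- Vectors are functions, so the enumeration is complete only pointwise.
  vectors-complete : ∀ {n b} (z : Vector ℕ n) → (∀ i → z i ℕ.< b) →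
                     ∃[ z′ ] z′ ∈ vectors n b × z′ ≗ z
  vectors-complete {zero}  z z<b = [] , here refl , λ ()
  vectors-complete {suc n} z z<b with vectors-complete (z ∘ suc) (z<b ∘ suc)
  ... | z′ , z′∈ , z′≗z =
    z zero ∷ z′ , ∈-cartesianProductWith⁺ _∷_ (∈-upTo⁺ (z<b zero)) z′∈ ,
    λ { zero → refl ; (suc i) → z′≗z i }

  objective-cong : ∀ k μ {z z′} → z ≗ z′ → objective k μ z ≡ objective k μ z′
  objective-cong k μ z≗z′ = cong (λ s → μ + s) (sum-cong-≗
    (λ i → cong (λ m → (+ m / 1) * ((+ 1 / idx i) - μ * (+ 1 / suc (idx i)))) (z≗z′ i)))

  weight-cong : ∀ k {z z′} → z ≗ z′ → weight k z ≡ weight k z′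
  weight-cong k z≗z′ = sum-cong-≗ (λ i → cong (λ m → + m / suc (idx i)) (z≗z′ i))

  feasible? : ∀ k z → Dec (Feasible k z)
  feasible? k z = weight k z ℚₚ.<? 1ℚ

  0-feasible : ∀ k → Feasible k (λ _ → 0)
  0-feasible k = subst (_< 1ℚ) (sym (weight0 (k ℕ.∸ 1) idx)) (ℚₚ.positive⁻¹ 1ℚ)
    where
    0/n : ∀ n → + 0 / suc n ≡ 0ℚ
    0/n n = ℚₚ.fromℚᵘ-cong {ℚᵘ.mkℚᵘ (+ 0) n} {ℚᵘ.mkℚᵘ (+ 0) 0} (ℚᵘ.*≡* refl)
    weight0 : ∀ n (d : Fin n → ℕ) → sum {n} (λ i → + 0 / suc (d i)) ≡ 0ℚ
    weight0 zero    d = refl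
    weight0 (suc n) d = cong₂ _+_ (0/n (d zero)) (weight0 n (d ∘ suc))

abstract

  optimum : ∀ k μ → ∃[ v ] IsOptimalValue k μ v
  optimum k μ = objective k μ best , (best , best-feasible , refl) , upper
    where
    open Data.List.Extrema (DecTotalOrder.totalOrder ℚₚ.≤-decTotalOrder)

    candidates : List (Vector ℕ (k ℕ.∸ 1))
    candidates = filter (feasible? k) (vectors (k ℕ.∸ 1) (suc (k ℕ.∸ 1)))

    best : Vector ℕ (k ℕ.∸ 1)
    best = argmax (objective k μ) (λ _ → 0) candidates

    best-feasible : Feasible k best
    best-feasible = argmax-all (objective k μ) {P = Feasible k} (0-feasible k)
      (all-filter (feasible? k) (vectors (k ℕ.∸ 1) (suc (k ℕ.∸ 1))))

    upper : ∀ z → Feasible k z → objective k μ z ≤ objective k μ best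
    upper z fz =
      let z′ , z′∈ , z′≗z = vectors-complete z (feasible-bounded k z fz) in
      subst (_≤ objective k μ best) (objective-cong k μ z′≗z)
        (All.lookup (f[xs]≤f[argmax] {f = objective k μ} (λ _ → 0) candidates)
          (∈-filter⁺ (feasible? k) z′∈
            (subst (_< 1ℚ) (sym (weight-cong k z′≗z)) fz)))

opt : ℕ → ℚ → ℚ
opt k μ = proj₁ (optimum k μ)

opt-isOptimalValue : ∀ k μ → IsOptimalValue k μ (opt k μ)
opt-isOptimalValue k μ = proj₂ (optimum k μ)

-- Real numbers in the sense of Bishop: regular sequences of rationals, where
-- approx n is within 1/(n+1) of the real represented.
record ℝ : Set where
  field
    approx  : ℕ → ℚ
    regular : ∀ m n → ∣ approx m - approx n ∣ ≤ (+ 1 / suc m) + (+ 1 / suc n)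

-- Within x q ε is | x - q | ≤ ε, for x real and q , ε rational.
Within : ℝ → ℚ → ℚ → Set
Within x q ε = ∀ n → ∣ ℝ.approx x n - q ∣ ≤ ε + (+ 1 / suc n)

infix 4 _⟶_

_⟶_ : (ℕ → ℚ) → ℝ → Set
a ⟶ x = ∀ ε → 0ℚ < ε → ∃[ N ] ∀ n → N ℕ.≤ n → Within x (a n) ε

{-# OPTIONS --safe #-}

-- Let t₀ = 1 and tₙ₊₁ = tₙ (tₙ + 1), so that 1/tₙ - 1/(tₙ + 1) = 1/tₙ₊₁. Writing
-- w for the weight of z, the objective is 1 + Σ zⱼ / (j(j+1)) + (μ - 1)(1 - w), and
-- the last term vanishes in the limit. Suppose the remaining capacity is 1/tₙ. If an
-- item of size 1/(tₙ + 1) is used, it gains 1/tₙ₊₁ and leaves capacity 1/tₙ₊₁.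
-- Otherwise every item j has j > tₙ, hence profit at most 1/(tₙ + 1) per unit of size,
-- and the total gain is already at most 1/tₙ₊₁. So taking the items t₀, t₁, … greedily
-- is optimal in the limit, and T∞ = Σ 1/tᵢ.
module Submission where

open import Defs
open import Data.Nat.Base as ℕ using (ℕ; zero; suc; _∸_)
import Data.Nat.Properties as ℕₚ
open import Data.Nat.Solver using () renaming (module +-*-Solver to ℕ-Solver)
open import Data.Integer.Base as ℤ using (+_)
import Data.Integer.Properties as ℤₚ
open import Data.Rational.Base using (ℚ; 0ℚ; 1ℚ; _/_; _+_; _-_; -_; _*_; ∣_∣; _≤_; _<_; fromℚᵘ; mkℚ; nonNegative; positive)
import Data.Rational.Properties as ℚₚ
open import Data.Rational.Solver using () renaming (module +-*-Solver to ℚ-Solver)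
import Data.Rational.Unnormalised.Base as ℚᵘ
import Data.Rational.Unnormalised.Properties as ℚᵘₚ
open import Data.Fin.Base using (Fin; zero; suc; toℕ; fromℕ<)
import Data.Fin.Properties as Finₚ
open import Data.Product.Base using (Σ-syntax; ∃-syntax; _×_; _,_; proj₁; proj₂)
open import Data.Vec.Functional using (Vector; updateAt)
import Data.Vec.Functional.Properties as Vecₚ
open import Algebra.Bundles using (CommutativeRing)
open import Algebra.Properties.Semiring.Sum
  (CommutativeRing.semiring ℚₚ.+-*-commutativeRing)
  using (∑-distrib-+; *-distribˡ-sum)
open import Function.Base using (_∘_; case_of_)
open import Relation.Nullary using (yes; no)
open import Relation.Nullary.Decidable using (toWitness; ¬?; _×-dec_; decidable-stable)
open import Data.Sum.Base using (inj₁; inj₂)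
open import Relation.Binary.PropositionalEquality
  using (_≡_; _≢_; _≗_; refl; sym; trans; cong; cong₂; subst; subst₂; module ≡-Reasoning)

-- Fractions with natural numerators.

/-cong-* : ∀ m a n b → m ℕ.* suc b ≡ n ℕ.* suc a → + m / suc a ≡ + n / suc b
/-cong-* m a n b eq = ℚₚ.fromℚᵘ-cong {ℚᵘ.mkℚᵘ (+ m) a} {ℚᵘ.mkℚᵘ (+ n) b}
  (ℚᵘ.*≡* (trans (sym (ℤₚ.pos-* m (suc b))) (trans (cong +_ eq) (ℤₚ.pos-* n (suc a)))))

-- Normalisation in `ℚ` blocks computation with variables, so sums and products are taken
-- unnormalised and carried back.
fromℚᵘ-+ : ∀ p q → fromℚᵘ p + fromℚᵘ q ≡ fromℚᵘ (p ℚᵘ.+ q)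
fromℚᵘ-+ p q = ℚₚ.toℚᵘ-injective (ℚᵘₚ.≃-trans (ℚₚ.toℚᵘ-homo-+ (fromℚᵘ p) (fromℚᵘ q))
  (ℚᵘₚ.≃-trans (ℚᵘₚ.+-cong (ℚₚ.toℚᵘ-fromℚᵘ p) (ℚₚ.toℚᵘ-fromℚᵘ q))
    (ℚᵘₚ.≃-sym (ℚₚ.toℚᵘ-fromℚᵘ (p ℚᵘ.+ q)))))

fromℚᵘ-* : ∀ p q → fromℚᵘ p * fromℚᵘ q ≡ fromℚᵘ (p ℚᵘ.* q)
fromℚᵘ-* p q = ℚₚ.toℚᵘ-injective (ℚᵘₚ.≃-trans (ℚₚ.toℚᵘ-homo-* (fromℚᵘ p) (fromℚᵘ q))
  (ℚᵘₚ.≃-trans (ℚᵘₚ.*-cong (ℚₚ.toℚᵘ-fromℚᵘ p) (ℚₚ.toℚᵘ-fromℚᵘ q))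
    (ℚᵘₚ.≃-sym (ℚₚ.toℚᵘ-fromℚᵘ (p ℚᵘ.* q)))))

/-homo-+ : ∀ m a n b →
  + m / suc a + + n / suc b ≡ + (m ℕ.* suc b ℕ.+ n ℕ.* suc a) / (suc a ℕ.* suc b)
/-homo-+ m a n b = trans (fromℚᵘ-+ (ℚᵘ.mkℚᵘ (+ m) a) (ℚᵘ.mkℚᵘ (+ n) b))
  (cong (_/ (suc a ℕ.* suc b)) (cong₂ ℤ._+_ (sym (ℤₚ.pos-* m (suc b))) (sym (ℤₚ.pos-* n (suc a)))))

/-homo-* : ∀ m a n b → (+ m / suc a) * (+ n / suc b) ≡ + (m ℕ.* n) / (suc a ℕ.* suc b)
/-homo-* m a n b = trans (fromℚᵘ-* (ℚᵘ.mkℚᵘ (+ m) a) (ℚᵘ.mkℚᵘ (+ n) b))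
  (cong (_/ (suc a ℕ.* suc b)) (sym (ℤₚ.pos-* m n)))

/-mono-≤ : ∀ m a n b → m ℕ.* suc b ℕ.≤ n ℕ.* suc a → + m / suc a ≤ + n / suc b
/-mono-≤ m a n b le = ℚₚ.toℚᵘ-cancel-≤
  (ℚᵘₚ.≤-respˡ-≃ (ℚᵘₚ.≃-sym (ℚₚ.toℚᵘ-fromℚᵘ (ℚᵘ.mkℚᵘ (+ m) a)))
  (ℚᵘₚ.≤-respʳ-≃ (ℚᵘₚ.≃-sym (ℚₚ.toℚᵘ-fromℚᵘ (ℚᵘ.mkℚᵘ (+ n) b)))
  (ℚᵘ.*≤* (subst₂ ℤ._≤_ (ℤₚ.pos-* m (suc b)) (ℤₚ.pos-* n (suc a)) (ℤ.+≤+ le)))))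

1/1+_ : ℕ → ℚ
1/1+ n = + 1 / suc n

infix 8 1/1+_

1/1+-antimono : ∀ {m n} → m ℕ.≤ n → 1/1+ n ≤ 1/1+ m
1/1+-antimono {m} {n} m≤n = /-mono-≤ 1 n 1 m (ℕₚ.*-monoʳ-≤ 1 (ℕ.s≤s m≤n))

0≤m/n : ∀ m n → 0ℚ ≤ + m / suc n
0≤m/n m n = /-mono-≤ 0 0 m n ℕ.z≤n

-- suc (next n) = suc n * suc (suc n), definitionally.
next : ℕ → ℕ
next n = suc n ℕ.+ n ℕ.* suc (suc n)

1/1+-split : ∀ n → 1/1+ suc n + 1/1+ next n ≡ 1/1+ n
1/1+-split n = trans (/-homo-+ 1 (suc n) 1 (next n)) (/-cong-* (1 ℕ.* suc (next n) ℕ.+ 1 ℕ.* suc (suc n)) _ 1 n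
  (solve 1 (λ x → let y = con 1 :+ x ; s = con 1 :+ y ; t = con 1 :+ (y :+ x :* s) in
    (con 1 :* t :+ con 1 :* s) :* y := con 1 :* (s :* t)) refl n))
  where open ℕ-Solver

-- With `1/1+-split`, the product and the difference of consecutive unit fractions agree: the profit
-- of item j is both 1/j minus its size and 1/j times its size.
1/1+-* : ∀ n → 1/1+ n * 1/1+ suc n ≡ 1/1+ next n
1/1+-* n = /-homo-* 1 n 1 (suc n)

m/1+n : ∀ m n → + m / suc n ≡ (+ m / 1) * 1/1+ n
m/1+n m n = sym (trans (/-homo-* m 0 1 n) (/-cong-* (m ℕ.* 1) _ m n
  (solve 2 (λ m n → (m :* con 1) :* n := m :* (con 1 :* n)) refl m (suc n))))
  where open ℕ-Solver

suc/1 : ∀ m → + suc m / 1 ≡ (+ m / 1) + 1ℚ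
suc/1 m = sym (trans (/-homo-+ m 0 1 0) (/-cong-* (m ℕ.* 1 ℕ.+ 1) 0 (suc m) 0
  (solve 1 (λ m → (m :* con 1 :+ con 1) :* con 1 := (con 1 :+ m) :* con 1) refl m)))
  where open ℕ-Solver

-- Sequences bracketing the limit.

-- suc (u n) = tₙ, and u n is also the coordinate (counted from 0) of the item j = tₙ.
u : ℕ → ℕ
u zero    = 0
u (suc n) = next (u n)

-- `S n` is the partial sum 1/t₀ + ... + 1/tₙ. The extra 1/tₙ in `U n` bounds everything that
-- capacity 1/tₙ can still gain.
S U : ℕ → ℚ
S zero    = 1ℚ
S (suc n) = S n + 1/1+ u (suc n)
U n = S n + 1/1+ u n

p≤p+q : ∀ {p q} → 0ℚ ≤ q → p ≤ p + q
p≤p+q {p} {q} 0≤q = subst (_≤ p + q) (ℚₚ.+-identityʳ p) (ℚₚ.+-monoʳ-≤ p 0≤q)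

u<u : ∀ n → u n ℕ.< u (suc n)
u<u n = ℕₚ.m≤m+n (suc (u n)) _

n≤u : ∀ n → n ℕ.≤ u n
n≤u zero    = ℕ.z≤n
n≤u (suc n) = ℕₚ.≤-trans (ℕ.s≤s (n≤u n)) (u<u n)

S≤S-suc : ∀ n → S n ≤ S (suc n)
S≤S-suc n = p≤p+q (0≤m/n 1 (u (suc n)))

-- Since tₙ₊₁ ≥ tₙ + 1, one of the two copies of 1/tₙ₊₁ may be enlarged to 1/(tₙ + 1); together they
-- then make 1/tₙ.
U-suc≤U : ∀ n → U (suc n) ≤ U n
U-suc≤U n = begin
  (S n + 1/1+ u (suc n)) + 1/1+ u (suc n)  ≡⟨ ℚₚ.+-assoc (S n) _ _ ⟩
  S n + (1/1+ u (suc n) + 1/1+ u (suc n))  ≤⟨ ℚₚ.+-monoʳ-≤ (S n) (ℚₚ.+-monoˡ-≤ (1/1+ u (suc n)) (1/1+-antimono (u<u n))) ⟩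
  S n + (1/1+ suc (u n) + 1/1+ u (suc n))  ≡⟨ cong (λ x → S n + x) (1/1+-split (u n)) ⟩
  U n                                      ∎
  where open ℚₚ.≤-Reasoning

S-mono : ∀ d n → S n ≤ S (d ℕ.+ n)
S-mono zero    n = ℚₚ.≤-refl
S-mono (suc d) n = ℚₚ.≤-trans (S-mono d n) (S≤S-suc (d ℕ.+ n))

U-antimono : ∀ d n → U (d ℕ.+ n) ≤ U n
U-antimono zero    n = ℚₚ.≤-refl
U-antimono (suc d) n = ℚₚ.≤-trans (U-suc≤U (d ℕ.+ n)) (U-antimono d n)

S≤U : ∀ m n → S m ≤ U n
S≤U m n = begin
  S m          ≤⟨ S-mono n m ⟩
  S (n ℕ.+ m)  ≤⟨ p≤p+q (0≤m/n 1 (u (n ℕ.+ m))) ⟩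
  U (n ℕ.+ m)  ≡⟨ cong U (ℕₚ.+-comm n m) ⟩
  U (m ℕ.+ n)  ≤⟨ U-antimono m n ⟩
  U n          ∎
  where open ℚₚ.≤-Reasoning

∣p-q∣≤ : ∀ {p q r} → p ≤ q + r → q ≤ p + r → ∣ p - q ∣ ≤ r
∣p-q∣≤ {p} {q} {r} p≤ q≤ with ℚₚ.∣p∣≡p∨∣p∣≡-p (p - q)
... | inj₁ eq = subst (_≤ r) (sym eq) (begin
  p - q        ≤⟨ ℚₚ.+-monoˡ-≤ (- q) p≤ ⟩
  (q + r) - q  ≡⟨ solve 2 (λ q r → (q :+ r) :- q := r) refl q r ⟩
  r            ∎)
  where open ℚₚ.≤-Reasoning
        open ℚ-Solver
... | inj₂ eq = subst (_≤ r) (sym eq) (begin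
  - (p - q)    ≡⟨ solve 2 (λ p q → :- (p :- q) := q :- p) refl p q ⟩
  q - p        ≤⟨ ℚₚ.+-monoˡ-≤ (- p) q≤ ⟩
  (p + r) - p  ≡⟨ solve 2 (λ q r → (q :+ r) :- q := r) refl p r ⟩
  r            ∎)
  where open ℚₚ.≤-Reasoning
        open ℚ-Solver

-- The approximation is read as correct rounding: `e₀` is half a unit in the fifteenth decimal
-- place.
q₀ e₀ : ℚ
q₀ = + 1691030206757254 / 10 ℕ.^ 15
e₀ = + 1 / (2 ℕ.* 10 ℕ.^ 15)

-- 7 is the least n for which U n - T∞ is small enough: 1/t₆ is about 10⁻¹³.
q₀≤S₇+e₀ : q₀ ≤ S 7 + e₀
q₀≤S₇+e₀ = toWitness {a? = q₀ ℚₚ.≤? S 7 + e₀} _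

U₇≤q₀+e₀ : U 7 ≤ q₀ + e₀
U₇≤q₀+e₀ = toWitness {a? = U 7 ℚₚ.≤? q₀ + e₀} _

p≤q+p : ∀ {p} q → 0ℚ ≤ p → q ≤ p + q
p≤q+p {p} q 0≤p = subst (q ≤_) (ℚₚ.+-comm q p) (p≤p+q 0≤p)

1+1/1+ : ∀ d → + (2 ℕ.+ d) / suc d ≡ 1/1+ d + 1ℚ
1+1/1+ d = sym (trans (/-homo-+ 1 d 1 0) (/-cong-* (1 ℕ.* 1 ℕ.+ 1 ℕ.* suc d) _ (2 ℕ.+ d) d
  (solve 1 (λ d → (con 1 :* con 1 :+ con 1 :* (con 1 :+ d)) :* (con 1 :+ d)
    := (con 2 :+ d) :* ((con 1 :+ d) :* con 1)) refl d)))
  where open ℕ-Solver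

-- Cross-multiplied form of 1 + 2/(n+1) ≤ 1 + 1/(d+1), used to make μ - 1 small.
3+n/1+n≤2+d/1+d : ∀ {d n} → 2 ℕ.* suc d ℕ.≤ n → (3 ℕ.+ n) ℕ.* suc d ℕ.≤ (2 ℕ.+ d) ℕ.* suc n
3+n/1+n≤2+d/1+d {d} {n} le = begin
  (3 ℕ.+ n) ℕ.* suc d                   ≡⟨ solve 2 (λ n d → (con 3 :+ n) :* d := con 2 :* d :+ (con 1 :+ n) :* d) refl n (suc d) ⟩
  2 ℕ.* suc d ℕ.+ suc n ℕ.* suc d       ≤⟨ ℕₚ.+-monoˡ-≤ (suc n ℕ.* suc d) (ℕₚ.≤-trans le (ℕₚ.n≤1+n n)) ⟩
  suc n ℕ.+ suc n ℕ.* suc d             ≡⟨ solve 2 (λ n d → n :+ n :* d := (con 1 :+ d) :* n) refl (suc n) (suc d) ⟩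
  (2 ℕ.+ d) ℕ.* suc n                   ∎
  where open ℕₚ.≤-Reasoning
        open ℕ-Solver

-- Linear functions of a multiset of items.

L : ∀ {n} → Vector ℚ n → Vector ℕ n → ℚ
L {n} f z = ∑[ i < n ] ((+ z i / 1) * f i)

L-cong : ∀ {n} {f g : Vector ℚ n} {z z′} → f ≗ g → z ≗ z′ → L f z ≡ L g z′
L-cong f≗g z≗z′ = sum-cong-≗ (λ i → cong₂ (λ m p → (+ m / 1) * p) (z≗z′ i) (f≗g i))

m*-mono-≤ : ∀ m {p q} → (m ≢ 0 → p ≤ q) → (+ m / 1) * p ≤ (+ m / 1) * q
m*-mono-≤ zero    {p} {q} p≤q = ℚₚ.≤-reflexive (trans (ℚₚ.*-zeroˡ p) (sym (ℚₚ.*-zeroˡ q)))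
m*-mono-≤ (suc m) {p} {q} p≤q =
  ℚₚ.*-monoˡ-≤-nonNeg (+ suc m / 1) {{nonNegative (0≤m/n (suc m) 0)}} (p≤q λ ())

-- Only items that occur in `z` are compared, because `profit-without-item` can bound the profit of
-- those alone.
L-mono-≤ : ∀ {n} {f g : Vector ℚ n} z → (∀ i → z i ≢ 0 → f i ≤ g i) → L f z ≤ L g z
L-mono-≤ {zero}  z f≤g = ℚₚ.≤-refl
L-mono-≤ {suc n} z f≤g =
  ℚₚ.+-mono-≤ (m*-mono-≤ (z zero) (f≤g zero)) (L-mono-≤ (z ∘ suc) (f≤g ∘ suc))

L-zero : ∀ {n} (f : Vector ℚ n) → L f (λ _ → 0) ≡ 0ℚ
L-zero {zero}  f = refl
L-zero {suc n} f = cong₂ _+_ (ℚₚ.*-zeroˡ (f zero)) (L-zero (f ∘ suc))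

L-+ : ∀ {n} (f g : Vector ℚ n) z → L (λ i → f i + g i) z ≡ L f z + L g z
L-+ f g z = trans (sum-cong-≗ (λ i → ℚₚ.*-distribˡ-+ (+ z i / 1) (f i) (g i)))
  (∑-distrib-+ (λ i → (+ z i / 1) * f i) (λ i → (+ z i / 1) * g i))

L-* : ∀ {n} c (f : Vector ℚ n) z → L (λ i → c * f i) z ≡ c * L f z
L-* c f z = trans
  (sum-cong-≗ (λ i → solve 3 (λ m c p → m :* (c :* p) := c :* (m :* p)) refl (+ z i / 1) c (f i)))
  (sym (*-distribˡ-sum c (λ i → (+ z i / 1) * f i)))
  where open ℚ-Solver

L-incr : ∀ {n} (f : Vector ℚ n) z i → L f (updateAt z i suc) ≡ L f z + f i
L-incr f z zero = trans
  (cong (λ m → m * f zero + L (f ∘ suc) (z ∘ suc)) (suc/1 (z zero)))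
  (solve 3 (λ m p s → (m :+ con 1ℚ) :* p :+ s := (m :* p :+ s) :+ p) refl
    (+ z zero / 1) (f zero) (L (f ∘ suc) (z ∘ suc)))
  where open ℚ-Solver
L-incr f z (suc i) = trans
  (cong (λ s → (+ z zero / 1) * f zero + s) (L-incr (f ∘ suc) (z ∘ suc) i))
  (sym (ℚₚ.+-assoc ((+ z zero / 1) * f zero) (L (f ∘ suc) (z ∘ suc)) (f (suc i))))

-- Putting the removed copy back restores `z` when `z i` is nonzero, so this is `L-incr` read
-- backwards.
L-decr : ∀ {n} (f : Vector ℚ n) z i → z i ≢ 0 → L f z ≡ L f (updateAt z i ℕ.pred) + f i
L-decr f z i zi≢0 = trans
  (L-cong (λ _ → refl) (λ j → sym (trans
    (Vecₚ.updateAt-updateAt i z j)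
    (Vecₚ.updateAt-id-local i z (ℕₚ.suc-pred (z i) {{ℕ.≢-nonZero zi≢0}}) j))))
  (L-incr f (updateAt z i ℕ.pred) i)

L-nonNeg : ∀ {n} {f : Vector ℚ n} → (∀ i → 0ℚ ≤ f i) → ∀ z → 0ℚ ≤ L f z
L-nonNeg {f = f} 0≤f z = begin
  0ℚ                    ≡⟨ ℚₚ.*-zeroˡ (L f z) ⟨
  0ℚ * L f z            ≡⟨ L-* 0ℚ f z ⟨
  L (λ i → 0ℚ * f i) z  ≤⟨ L-mono-≤ z (λ i _ → subst (_≤ f i) (sym (ℚₚ.*-zeroˡ (f i))) (0≤f i)) ⟩
  L f z                 ∎
  where open ℚₚ.≤-Reasoning

-- Optimality of the greedy choice.

-- Per item: weight 1/(j+1), and profit 1/(j(j+1)), the coefficient of zⱼ for μ = 1.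
size profit : ∀ {n} → Vector ℚ n
size   i = 1/1+ suc (toℕ i)
profit i = 1/1+ next (toℕ i)

size≤L : ∀ {n} (z : Vector ℕ n) i → z i ≢ 0 → size i ≤ L size z
size≤L z i zi≢0 = begin
  size i              ≤⟨ p≤p+q (L-nonNeg (λ j → 0≤m/n 1 (suc (toℕ j))) z′) ⟩
  size i + L size z′  ≡⟨ ℚₚ.+-comm (size i) (L size z′) ⟩
  L size z′ + size i  ≡⟨ L-decr size z i zi≢0 ⟨
  L size z            ∎
  where
  open ℚₚ.≤-Reasoning
  z′ = updateAt z i ℕ.pred

+-cancelʳ-< : ∀ p {q r} → q + p < r + p → q < r
+-cancelʳ-< p {q} {r} lt = subst₂ _<_ (cancel q) (cancel r) (ℚₚ.+-monoˡ-< (- p) lt)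
  where
  open ℚ-Solver
  cancel : ∀ q → (q + p) - p ≡ q
  cancel q = solve 2 (λ q p → (q :+ p) :- p := q) refl q p

-- One greedy step: a copy of item tₘ is removed from `z` and its profit is credited to the partial
-- sum. What remains fits into the next capacity.
profit-with-item : ∀ m {n} (z : Vector ℕ n) i → toℕ i ≡ u m → z i ≢ 0 → L size z < 1/1+ u m →
  let z′ = updateAt z i ℕ.pred in
  L size z′ < 1/1+ u (suc m) × S m + L profit z ≡ S (suc m) + L profit z′
profit-with-item m z i i≡ zi≢0 w< =
  +-cancelʳ-< (1/1+ suc (u m)) (subst₂ _<_
    (trans (L-decr size z i zi≢0) (cong (λ j → L size z′ + 1/1+ suc j) i≡))
    (trans (sym (1/1+-split (u m))) (ℚₚ.+-comm (1/1+ suc (u m)) (1/1+ u (suc m))))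
    w<) , (begin
  S m + L profit z                      ≡⟨ cong (λ x → S m + x) (L-decr profit z i zi≢0) ⟩
  S m + (L profit z′ + profit i)        ≡⟨ cong (λ j → S m + (L profit z′ + 1/1+ next j)) i≡ ⟩
  S m + (L profit z′ + 1/1+ u (suc m))  ≡⟨ cong (λ x → S m + x) (ℚₚ.+-comm (L profit z′) (1/1+ u (suc m))) ⟩
  S m + (1/1+ u (suc m) + L profit z′)  ≡⟨ ℚₚ.+-assoc (S m) (1/1+ u (suc m)) (L profit z′) ⟨
  S (suc m) + L profit z′               ∎)
  where
  open ≡-Reasoning
  z′ = updateAt z i ℕ.pred

profit-without-item : ∀ m {n} (z : Vector ℕ n) → (∀ i → toℕ i ≡ u m → z i ≡ 0) →
  L size z < 1/1+ u m → S m + L profit z ≤ S (suc m)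
profit-without-item m z unused w< = begin
  S m + L profit z              ≤⟨ ℚₚ.+-monoʳ-≤ (S m) (L-mono-≤ z profit≤) ⟩
  S m + L (λ i → c * size i) z  ≡⟨ cong (λ x → S m + x) (L-* c size z) ⟩
  S m + c * L size z            ≤⟨ ℚₚ.+-monoʳ-≤ (S m) (ℚₚ.*-monoˡ-≤-nonNeg c {{nonNegative (0≤m/n 1 (suc (u m)))}} (ℚₚ.<⇒≤ w<)) ⟩
  S m + c * 1/1+ u m            ≡⟨ cong (λ x → S m + x) (trans (ℚₚ.*-comm c (1/1+ u m)) (1/1+-* (u m))) ⟩
  S (suc m)                     ∎
  where
  open ℚₚ.≤-Reasoning
  c = 1/1+ suc (u m)
  u<i : ∀ i → z i ≢ 0 → u m ℕ.< toℕ i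
  u<i i zi≢0 = ℕₚ.≤∧≢⇒<
    (ℕₚ.≮⇒≥ (λ i<u → ℚₚ.<-irrefl refl
      (ℚₚ.<-≤-trans w< (ℚₚ.≤-trans (1/1+-antimono i<u) (size≤L z i zi≢0)))))
    (λ u≡i → zi≢0 (unused i (sym u≡i)))
  profit≤ : ∀ i → z i ≢ 0 → profit i ≤ c * size i
  profit≤ i zi≢0 = subst (_≤ c * size i) (1/1+-* (toℕ i))
    (ℚₚ.*-monoʳ-≤-nonNeg (size i) {{nonNegative (0≤m/n 1 (suc (toℕ i)))}} (1/1+-antimono (u<i i zi≢0)))

-- Induction on the number `d` of greedy levels still to examine. Each step down trades one from `d`
-- to `m`, so the target index stays fixed; a level whose item is absent ends the descent at once.
profit≤U : ∀ d m {n} (z : Vector ℕ n) → L size z < 1/1+ u m → S m + L profit z ≤ U (d ℕ.+ m)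
profit≤U zero m z w< = ℚₚ.+-monoʳ-≤ (S m) (ℚₚ.≤-trans
  -- No item has profit above its size, so the remaining gain is at most the remaining capacity
  -- 1/tₘ.
  (L-mono-≤ z (λ i _ → 1/1+-antimono (ℕₚ.m≤m+n (suc (toℕ i)) _)))
  (ℚₚ.<⇒≤ w<))
profit≤U (suc d) m z w< =
  case Finₚ.any? (λ i → (toℕ i ℕₚ.≟ u m) ×-dec ¬? (z i ℕₚ.≟ 0)) of λ
    { (yes (i , i≡ , zi≢0)) →
        let w′< , profit≡ = profit-with-item m z i i≡ zi≢0 w< in
        subst₂ _≤_ (sym profit≡) (cong U (ℕₚ.+-suc d m))
          (profit≤U d (suc m) (updateAt z i ℕ.pred) w′<)
    ; (no ¬∃) → ℚₚ.≤-trans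
        (profit-without-item m z
          (λ i i≡ → decidable-stable (z i ℕₚ.≟ 0) (λ zi≢0 → ¬∃ (i , i≡ , zi≢0))) w<)
        (S≤U (suc m) (suc d ℕ.+ m))
    }

-- The witness has one copy of each item t₀, ..., tₘ₋₁. Their sizes are the reciprocals of
-- Sylvester's sequence 2, 3, 7, 43, ... and the sum telescopes. All coordinates used lie below
-- `u m`, hence below `n`.
sylvester : ∀ m {n} → u m ℕ.≤ n →
  ∃[ z ] L {n} size z + 1/1+ u m ≡ 1ℚ × 1ℚ + L profit z ≡ S m
sylvester zero    {n} _ = (λ _ → 0) ,
  cong (_+ 1ℚ) (L-zero {n} size) , cong (λ x → 1ℚ + x) (L-zero {n} profit)
sylvester (suc m) {n} u≤n =
  let z , w≡ , v≡ = sylvester m (ℕₚ.≤-trans (ℕₚ.<⇒≤ (u<u m)) u≤n) in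
  updateAt z p suc , (begin
    L size (updateAt z p suc) + 1/1+ u (suc m)    ≡⟨ cong (_+ 1/1+ u (suc m)) (L-incr size z p) ⟩
    (L size z + size p) + 1/1+ u (suc m)          ≡⟨ ℚₚ.+-assoc (L size z) (size p) (1/1+ u (suc m)) ⟩
    L size z + (size p + 1/1+ u (suc m))          ≡⟨ cong (λ j → L size z + (1/1+ suc j + 1/1+ u (suc m))) p≡ ⟩
    L size z + (1/1+ suc (u m) + 1/1+ u (suc m))  ≡⟨ cong (λ x → L size z + x) (1/1+-split (u m)) ⟩
    L size z + 1/1+ u m                           ≡⟨ w≡ ⟩
    1ℚ                                            ∎) , (begin
    1ℚ + L profit (updateAt z p suc)              ≡⟨ cong (λ x → 1ℚ + x) (L-incr profit z p) ⟩
    1ℚ + (L profit z + profit p)                  ≡⟨ ℚₚ.+-assoc 1ℚ (L profit z) (profit p) ⟨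
    (1ℚ + L profit z) + profit p                  ≡⟨ cong₂ (λ x j → x + 1/1+ next j) v≡ p≡ ⟩
    S (suc m)                                     ∎)
  where
  open ≡-Reasoning
  p = fromℕ< (ℕₚ.<-≤-trans (u<u m) u≤n)
  p≡ : toℕ p ≡ u m
  p≡ = Finₚ.toℕ-fromℕ< (ℕₚ.<-≤-trans (u<u m) u≤n)

-- Bounds on the optimum.

weight≡ : ∀ k z → weight k z ≡ L size z
weight≡ k z = sum-cong-≗ (λ i → m/1+n (z i) (suc (toℕ i)))

-- Writing 1/j - μ/(j+1) as 1/(j(j+1)) + (1 - μ)/(j+1) isolates μ in a slack term, which lies
-- between 0 and μ - 1 for feasible `z` and μ ≥ 1.
objective≡ : ∀ k μ z → objective k μ z ≡ (1ℚ + L profit z) + (μ - 1ℚ) * (1ℚ - weight k z)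
objective≡ k μ z = begin
  objective k μ z                                    ≡⟨ cong (λ x → μ + x) (L-cong {k ∸ 1} {z = z} {z} coeff (λ _ → refl)) ⟩
  μ + L (λ i → profit i + (1ℚ - μ) * size i) z       ≡⟨ cong (λ x → μ + x) (L-+ profit (λ i → (1ℚ - μ) * size i) z) ⟩
  μ + (L profit z + L (λ i → (1ℚ - μ) * size i) z)   ≡⟨ cong (λ x → μ + (L profit z + x)) (L-* (1ℚ - μ) size z) ⟩
  μ + (L profit z + (1ℚ - μ) * L size z)             ≡⟨ cong (λ x → μ + (L profit z + (1ℚ - μ) * x)) (weight≡ k z) ⟨
  μ + (L profit z + (1ℚ - μ) * weight k z)           ≡⟨ solve 3 (λ μ v w → μ :+ (v :+ (con 1ℚ :- μ) :* w)
                                                          := (con 1ℚ :+ v) :+ (μ :- con 1ℚ) :* (con 1ℚ :- w)) refl μ (L profit z) (weight k z) ⟩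
  (1ℚ + L profit z) + (μ - 1ℚ) * (1ℚ - weight k z)   ∎
  where
  open ≡-Reasoning
  open ℚ-Solver
  coeff : ∀ (i : Fin (k ∸ 1)) → 1/1+ toℕ i - μ * size i ≡ profit i + (1ℚ - μ) * size i
  coeff i = trans (cong (_- μ * size i) (sym (1/1+-split (toℕ i))))
    (solve 3 (λ s p μ → (s :+ p) :- μ :* s := p :+ (con 1ℚ :- μ) :* s) refl (size i) (profit i) μ)

p≤q⇒0≤q-p : ∀ {p q} → p ≤ q → 0ℚ ≤ q - p
p≤q⇒0≤q-p {p} {q} p≤q = subst (_≤ q - p) (ℚₚ.+-inverseʳ p) (ℚₚ.+-monoˡ-≤ (- p) p≤q)

1+profit≤objective : ∀ k {μ} z → Feasible k z → 1ℚ ≤ μ → 1ℚ + L profit z ≤ objective k μ z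
1+profit≤objective k {μ} z feasible 1≤μ =
  subst (1ℚ + L profit z ≤_) (sym (objective≡ k μ z)) (p≤p+q (ℚₚ.nonNegative⁻¹ _
    {{ℚₚ.nonNeg*nonNeg⇒nonNeg (μ - 1ℚ) {{nonNegative (p≤q⇒0≤q-p 1≤μ)}}
        (1ℚ - weight k z) {{nonNegative (p≤q⇒0≤q-p (ℚₚ.<⇒≤ feasible))}}}}))

S≤opt : ∀ m k {μ} → u m ℕ.≤ k ∸ 1 → 1ℚ ≤ μ → S m ≤ opt k μ
S≤opt m k {μ} u≤k 1≤μ =
  let z , w≡ , v≡ = sylvester m u≤k
      -- The greedy choice leaves capacity 1/tₘ > 0, so the strict constraint holds.
      feasible = subst₂ _<_ (trans (ℚₚ.+-identityʳ (L size z)) (sym (weight≡ k z))) w≡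
        (ℚₚ.+-monoʳ-< (L size z) (ℚₚ.positive⁻¹ (1/1+ u m) {{ℚₚ.normalize-pos 1 (suc (u m))}}))
  in subst (_≤ opt k μ) v≡ (ℚₚ.≤-trans (1+profit≤objective k z feasible 1≤μ)
       (proj₂ (opt-isOptimalValue k μ) z feasible))

objective≤U : ∀ m k {μ} z → Feasible k z → 1ℚ ≤ μ → objective k μ z ≤ U m + (μ - 1ℚ)
objective≤U m k {μ} z feasible 1≤μ =
  subst (_≤ U m + (μ - 1ℚ)) (sym (objective≡ k μ z)) (ℚₚ.+-mono-≤ profit≤ slack≤)
  where
  profit≤ : 1ℚ + L profit z ≤ U m
  -- The descent starts at level 0, where both the capacity 1/t₀ and `S 0` are 1.
  profit≤ = subst (λ j → 1ℚ + L profit z ≤ U j) (ℕₚ.+-identityʳ m)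
    (profit≤U m 0 z (subst (_< 1ℚ) (weight≡ k z) feasible))
  1-w≤1 : 1ℚ - weight k z ≤ 1ℚ
  1-w≤1 = ℚₚ.+-monoʳ-≤ 1ℚ (ℚₚ.neg-antimono-≤ (subst (0ℚ ≤_) (sym (weight≡ k z))
    (L-nonNeg (λ i → 0≤m/n 1 (suc (toℕ i))) z)))
  slack≤ : (μ - 1ℚ) * (1ℚ - weight k z) ≤ μ - 1ℚ
  slack≤ = subst ((μ - 1ℚ) * (1ℚ - weight k z) ≤_) (ℚₚ.*-identityʳ (μ - 1ℚ))
    (ℚₚ.*-monoˡ-≤-nonNeg (μ - 1ℚ) {{nonNegative (p≤q⇒0≤q-p 1≤μ)}} 1-w≤1)

opt≤U : ∀ m k {μ} → 1ℚ ≤ μ → opt k μ ≤ U m + (μ - 1ℚ)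
opt≤U m k {μ} 1≤μ =
  let z , feasible , objective≡opt = proj₁ (opt-isOptimalValue k μ) in
  subst (_≤ U m + (μ - 1ℚ)) objective≡opt (objective≤U m k z feasible 1≤μ)

-- The limit as a real number.

1/1+u[+7]≤ : ∀ n → 1/1+ u (n ℕ.+ 7) ≤ 1/1+ n
1/1+u[+7]≤ n = 1/1+-antimono (ℕₚ.≤-trans (ℕₚ.m≤m+n n 7) (n≤u (n ℕ.+ 7)))

S≤S[+7]+ : ∀ m n → S m ≤ S (n ℕ.+ 7) + 1/1+ n
S≤S[+7]+ m n = ℚₚ.≤-trans (S≤U m (n ℕ.+ 7)) (ℚₚ.+-monoʳ-≤ (S (n ℕ.+ 7)) (1/1+u[+7]≤ n))

-- The shift by 7 puts every approximation between `S 7` and `U 7`, where the decimal estimates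
-- apply. Regularity comes from the tail bound 1/tₙ₊₇ ≤ 1/(n+1).
T∞ : ℝ
T∞ = record
  { approx  = λ n → S (n ℕ.+ 7)
  ; regular = λ m n → ∣p-q∣≤
      (ℚₚ.≤-trans (S≤S[+7]+ (m ℕ.+ 7) n) (ℚₚ.+-monoʳ-≤ (S (n ℕ.+ 7)) (p≤q+p (1/1+ n) (0≤m/n 1 m))))
      (ℚₚ.≤-trans (S≤S[+7]+ (n ℕ.+ 7) m) (ℚₚ.+-monoʳ-≤ (S (m ℕ.+ 7)) (p≤p+q (0≤m/n 1 n))))
  }

T∞-decimal : Within T∞ q₀ e₀
T∞-decimal n = ℚₚ.≤-trans
  (∣p-q∣≤ (ℚₚ.≤-trans (S≤U (n ℕ.+ 7) 7) U₇≤q₀+e₀)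
    (ℚₚ.≤-trans q₀≤S₇+e₀ (ℚₚ.+-monoˡ-≤ e₀ (S-mono n 7))))
  (p≤p+q (0≤m/n 1 n))

1/1+-archimedean : ∀ ε → 0ℚ < ε → ∃[ d ] 1/1+ d ≤ ε
1/1+-archimedean ε 0<ε with ε | positive 0<ε
-- `mkℚ` stores the denominator minus one, so ε = (p+1)/(d+1) ≥ 1/(d+1).
... | ε′@(mkℚ (+ suc p) d _) | _ = d , subst (1/1+ d ≤_) (ℚₚ.fromℚᵘ-toℚᵘ ε′)
  (/-mono-≤ 1 d (suc p) d (ℕₚ.*-monoˡ-≤ (suc d) (ℕ.s≤s {0} {p} ℕ.z≤n)))

-- A squeeze between `S≤opt` and `opt≤U`, common to the three sequences. The upper bound on μ is
-- k/(k-2) at k = n + 3.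
opt⟶T∞ : ∀ (k : ℕ → ℕ) (μ : ℕ → ℚ) → (∀ n → n ℕ.≤ k n ∸ 1) →
  (∀ n → 1ℚ ≤ μ n) → (∀ n → μ n ≤ + (3 ℕ.+ n) / suc n) →
  (λ n → opt (k n) (μ n)) ⟶ T∞
opt⟶T∞ k μ n≤k 1≤μ μ≤ ε 0<ε with 1/1+-archimedean ε 0<ε
-- The summand `u d` makes room for the coordinates of the greedy choice; the other one forces μ - 1
-- ≤ 1/(d+1).
... | d , 1/1+d≤ε = u d ℕ.+ 2 ℕ.* suc d , λ n N≤n m → ∣p-q∣≤ (lower n N≤n m) (upper n N≤n m)
  where
  open ℚₚ.≤-Reasoning
  lower : ∀ n → u d ℕ.+ 2 ℕ.* suc d ℕ.≤ n → ∀ m → S (m ℕ.+ 7) ≤ opt (k n) (μ n) + (ε + 1/1+ m)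
  lower n N≤n m = begin
    S (m ℕ.+ 7)                    ≤⟨ S≤U (m ℕ.+ 7) d ⟩
    S d + 1/1+ u d                 ≤⟨ ℚₚ.+-mono-≤ S≤ (ℚₚ.≤-trans (1/1+-antimono (n≤u d)) 1/1+d≤ε) ⟩
    opt (k n) (μ n) + ε            ≤⟨ ℚₚ.+-monoʳ-≤ (opt (k n) (μ n)) (p≤p+q (0≤m/n 1 m)) ⟩
    opt (k n) (μ n) + (ε + 1/1+ m) ∎
    where
    S≤ : S d ≤ opt (k n) (μ n)
    S≤ = S≤opt d (k n) (ℕₚ.≤-trans (ℕₚ.m≤m+n (u d) _) (ℕₚ.≤-trans N≤n (n≤k n))) (1≤μ n)
  upper : ∀ n → u d ℕ.+ 2 ℕ.* suc d ℕ.≤ n → ∀ m → opt (k n) (μ n) ≤ S (m ℕ.+ 7) + (ε + 1/1+ m)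
  upper n N≤n m = begin
    -- With the index of `U` tied to the approximation, its tail is absorbed by 1/(m+1), leaving all
    -- of ε for μ - 1.
    opt (k n) (μ n)                                  ≤⟨ opt≤U (m ℕ.+ 7) (k n) (1≤μ n) ⟩
    (S (m ℕ.+ 7) + 1/1+ u (m ℕ.+ 7)) + (μ n - 1ℚ)    ≤⟨ ℚₚ.+-mono-≤ (ℚₚ.+-monoʳ-≤ (S (m ℕ.+ 7)) (1/1+u[+7]≤ m)) μ-1≤ε ⟩
    (S (m ℕ.+ 7) + 1/1+ m) + ε                       ≡⟨ solve 3 (λ s r e → (s :+ r) :+ e := s :+ (e :+ r)) refl (S (m ℕ.+ 7)) (1/1+ m) ε ⟩
    S (m ℕ.+ 7) + (ε + 1/1+ m)                       ∎
    where
    open ℚ-Solver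
    2+d≤n : 2 ℕ.* suc d ℕ.≤ n
    2+d≤n = ℕₚ.≤-trans (ℕₚ.m≤n+m (2 ℕ.* suc d) (u d)) N≤n
    μ-1≤ε : μ n - 1ℚ ≤ ε
    μ-1≤ε = begin
      μ n - 1ℚ                  ≤⟨ ℚₚ.+-monoˡ-≤ (- 1ℚ) (ℚₚ.≤-trans (μ≤ n)
                                    (/-mono-≤ (3 ℕ.+ n) n (2 ℕ.+ d) d (3+n/1+n≤2+d/1+d 2+d≤n))) ⟩
      + (2 ℕ.+ d) / suc d - 1ℚ  ≡⟨ cong (_- 1ℚ) (1+1/1+ d) ⟩
      (1/1+ d + 1ℚ) - 1ℚ        ≡⟨ solve 1 (λ r → (r :+ con 1ℚ) :- con 1ℚ := r) refl (1/1+ d) ⟩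
      1/1+ d                    ≤⟨ 1/1+d≤ε ⟩
      ε                         ∎

-- The three choices of μ.

1≤m/n : ∀ m n → suc n ℕ.≤ m → 1ℚ ≤ + m / suc n
1≤m/n m n n<m = /-mono-≤ 1 0 m n
  (subst₂ ℕ._≤_ (sym (ℕₚ.*-identityˡ (suc n))) (sym (ℕₚ.*-identityʳ m)) n<m)

mainTheorem3 : Σ[ T∞ ∈ ℝ ]
    ((λ n → let k = 2 ℕ.+ n in opt k (+ k / (k ∸ 1))) ⟶ T∞)
    × Within T∞ (+ 1691030206757254 / 10 ℕ.^ 15) (+ 1 / (2 ℕ.* 10 ℕ.^ 15))
    × ((λ n → let k = 3 ℕ.+ n in opt k (+ k / (k ∸ 2))) ⟶ T∞)
    × ((λ n → let k = 3 ℕ.+ n in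
    opt k (+ (k ℕ.* (k ∸ 2)) / (1 ℕ.+ (k ℕ.* k ∸ 3 ℕ.* k)))) ⟶ T∞)
mainTheorem3 = T∞
  , opt⟶T∞ (2 ℕ.+_) _ ℕₚ.n≤1+n
      (λ n → 1≤m/n (2 ℕ.+ n) n (ℕₚ.n≤1+n (suc n)))
      (λ n → /-mono-≤ (2 ℕ.+ n) n (3 ℕ.+ n) n (ℕₚ.*-monoˡ-≤ (suc n) (ℕₚ.n≤1+n (2 ℕ.+ n))))
  , T∞-decimal
  , opt⟶T∞ (3 ℕ.+_) _ (λ n → ℕₚ.m≤n+m n 2)
      (λ n → 1≤m/n (3 ℕ.+ n) n (ℕₚ.m≤n+m (suc n) 2))
      (λ n → ℚₚ.≤-refl)
  , opt⟶T∞ (3 ℕ.+_) _ (λ n → ℕₚ.m≤n+m n 2)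
      (λ n → 1≤m/n ((3 ℕ.+ n) ℕ.* suc n) (denominator n)
        (subst (λ b → suc b ℕ.≤ (3 ℕ.+ n) ℕ.* suc n) (sym (denominator≡ n)) (lower n)))
      (λ n → /-mono-≤ ((3 ℕ.+ n) ℕ.* suc n) (denominator n) (3 ℕ.+ n) n
        (subst (λ b → (3 ℕ.+ n) ℕ.* suc n ℕ.* suc n ℕ.≤ (3 ℕ.+ n) ℕ.* suc b) (sym (denominator≡ n)) (upper n)))
  where
  -- This is k² - 3k for k = n + 3, where the truncated subtraction is exact.
  denominator : ℕ → ℕ
  denominator n = (3 ℕ.+ n) ℕ.* (3 ℕ.+ n) ∸ 3 ℕ.* (3 ℕ.+ n)
  denominator≡ : ∀ n → denominator n ≡ n ℕ.* (3 ℕ.+ n)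
  denominator≡ n = sym (ℕₚ.*-distribʳ-∸ (3 ℕ.+ n) (3 ℕ.+ n) 3)
  open ℕ-Solver
  lower : ∀ n → suc (n ℕ.* (3 ℕ.+ n)) ℕ.≤ (3 ℕ.+ n) ℕ.* suc n
  lower n = subst (suc (n ℕ.* (3 ℕ.+ n)) ℕ.≤_)
    (solve 1 (λ n → (con 1 :+ n :* (con 3 :+ n)) :+ (con 2 :+ n)
      := (con 3 :+ n) :* (con 1 :+ n)) refl n)
    (ℕₚ.m≤m+n (suc (n ℕ.* (3 ℕ.+ n))) (2 ℕ.+ n))
  -- Cancelling n + 3 leaves (n+1)² ≤ 1 + n(n+3), whose two sides differ by n.
  upper : ∀ n → (3 ℕ.+ n) ℕ.* suc n ℕ.* suc n ℕ.≤ (3 ℕ.+ n) ℕ.* suc (n ℕ.* (3 ℕ.+ n))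
  upper n = subst₂ ℕ._≤_ (sym (ℕₚ.*-assoc (3 ℕ.+ n) (suc n) (suc n)))
    (cong ((3 ℕ.+ n) ℕ.*_)
      (solve 1 (λ n → (con 1 :+ n) :* (con 1 :+ n) :+ n
        := con 1 :+ n :* (con 3 :+ n)) refl n))
    (ℕₚ.*-monoʳ-≤ (3 ℕ.+ n) (ℕₚ.m≤m+n (suc n ℕ.* suc n) n))
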